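{- The reachability problem for transfer + copy $\mathbb Z$-VASS is undecidable, even when restricted to dimension $d=3$ (three counters).
   Context: An affine $\mathbb Z$-VASS is $\mathcal V=(d,Q,T)$ with $Q$ finite and $T\subseteq Q\times\mathbb Z^{d\times d}\times\mathbb Z^d\times Q$ finite; configurations are $q(\mathbf v)\in Q\times\mathbb Z^d$; $p(\mathbf u)\xrightarrow{t}q(\mathbf v)$ iff $t=(p,A,\mathbf b,q)\in T$ and $\mathbf v=A\mathbf u+\mathbf b$; $\xrightarrow{*}$ is the reflexive-transitive closure of the union of these relations. A transfer matrix is a matrix in $\{0,1\}^{d\times d}$ with exactly one $1$ in each column; a copy matrix is a matrix in $\{0,1\}^{d\times d}$ with exactly one $1$ in each row. A transfer + copy $\mathbb Z$-VASS is an affine $\mathbb Z$-VASS all of whose transition matrices belong to the monoid (under matrix multiplication) generated by all $d\times d$ transfer matrices and all $d\times d$ copy matrices. The reachability problem: given such $\mathcal V$ and configurations $p(\mathbf u),q(\mathbf v)$, decide whether $p(\mathbf u)\xrightarrow{*}q(\mathbf v)$. -}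

module Defs where

open import Data.Nat using (ℕ; zero; suc)
open import Data.Integer using (ℤ; +_; _+_; _*_)
open import Data.Fin using (Fin; zero; suc)
open import Data.List using (List)
open import Data.List.Membership.Propositional using (_∈_)
open import Data.Product using (Σ; _×_; _,_; ∃)
open import Data.Sum using (_⊎_)
open import Relation.Binary.PropositionalEquality using (_≡_)
open import Relation.Binary.Construct.Closure.ReflexiveTransitive using (Star)
open import Relation.Nullary using (¬_)
open import Function.Bundles using (_⇔_)

Vecℤ : ℕ → Set
Vecℤ d = Fin d → ℤ

-- A d×d integer matrix, indexed as  A i j  (row i, column j).
Mat : ℕ → Set
Mat d = Fin d → Fin d → ℤ

sumFin : ∀ {n} → (Fin n → ℤ) → ℤ
sumFin {zero}  f = + 0
sumFin {suc n} f = f zero + sumFin (λ i → f (suc i))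

_·_ : ∀ {d} → Mat d → Vecℤ d → Vecℤ d
(A · u) i = sumFin (λ j → A i j * u j)

_⊗_ : ∀ {d} → Mat d → Mat d → Mat d
(A ⊗ B) i k = sumFin (λ j → A i j * B j k)

identity : ∀ {d} → Mat d
identity i j with i Data.Fin.≟ j
... | Relation.Nullary.yes _ = + 1
... | Relation.Nullary.no  _ = + 0
  where import Data.Fin
        import Relation.Nullary

_+ᵥ_ : ∀ {d} → Vecℤ d → Vecℤ d → Vecℤ d
(u +ᵥ v) i = u i + v i

ZeroOne : ∀ {d} → Mat d → Set
ZeroOne A = ∀ i j → A i j ≡ + 0 ⊎ A i j ≡ + 1

IsTransfer : ∀ {d} → Mat d → Set
IsTransfer {d} A = ZeroOne A ×
  (∀ j → Σ (Fin d) λ i → A i j ≡ + 1 × (∀ i' → A i' j ≡ + 1 → i' ≡ i))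

IsCopy : ∀ {d} → Mat d → Set
IsCopy {d} A = ZeroOne A ×
  (∀ i → Σ (Fin d) λ j → A i j ≡ + 1 × (∀ j' → A i j' ≡ + 1 → j' ≡ j))

data InTransferCopyMonoid {d : ℕ} : Mat d → Set where
  unit     : ∀ {A} → (∀ i j → A i j ≡ identity i j) → InTransferCopyMonoid A
  transfer : ∀ {A} → IsTransfer A → InTransferCopyMonoid A
  copy     : ∀ {A} → IsCopy A → InTransferCopyMonoid A
  product  : ∀ {A B C} → InTransferCopyMonoid A → InTransferCopyMonoid B →
             (∀ i j → C i j ≡ (A ⊗ B) i j) → InTransferCopyMonoid C

record Transition (d nStates : ℕ) : Set where
  constructor trans
  field
    src : Fin nStates
    mat : Mat d
    vec : Vecℤ d
    tgt : Fin nStates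

record AffineZVASS (d : ℕ) : Set where
  field
    nStates     : ℕ
    transitions : List (Transition d nStates)

module _ {d : ℕ} (V : AffineZVASS d) where
  open AffineZVASS V

  Config : Set
  Config = Fin nStates × Vecℤ d

  Step : Config → Config → Set
  Step (p , u) (q , v) =
    Σ (Transition d nStates) λ t → t ∈ transitions ×
      (Transition.src t ≡ p × Transition.tgt t ≡ q ×
       (∀ i → v i ≡ ((Transition.mat t · u) +ᵥ Transition.vec t) i))

  Reach : Config → Config → Set
  Reach = Star Step

IsTransferCopy : ∀ {d} → AffineZVASS d → Set
IsTransferCopy {d} V = ∀ t → t ∈ AffineZVASS.transitions V →
  InTransferCopyMonoid (Transition.mat t)

record TCReachInstance (d : ℕ) : Set where
  field
    vass   : AffineZVASS d
    isTC   : IsTransferCopy vass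
    source : Config vass
    target : Config vass

TCReachable : ∀ {d} → TCReachInstance d → Set
TCReachable I = Reach vass source target
  where open TCReachInstance I

-- Two-counter Minsky machines (halting problem: undecidable, Minsky 1967)

data Instr (n : ℕ) : Set where
  inc  : Fin 2 → Fin n → Instr n            -- c_k++ ; goto j
  jzdec : Fin 2 → Fin n → Fin n → Instr n   -- if c_k = 0 goto j else (c_k-- ; goto j')
  halt : Instr n

record Minsky : Set where
  field
    nInstr  : ℕ
    program : Fin nInstr → Instr nInstr
    start   : Fin nInstr

module _ (M : Minsky) where
  open Minsky M

  MConfig : Set
  MConfig = Fin nInstr × ℕ × ℕ

  data MStep : MConfig → MConfig → Set where
    inc0 : ∀ {l j a b} → program l ≡ inc zero j → MStep (l , a , b) (j , suc a , b)
    inc1 : ∀ {l j a b} → program l ≡ inc (suc zero) j → MStep (l , a , b) (j , a , suc b)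
    jz0  : ∀ {l j j' b} → program l ≡ jzdec zero j j' → MStep (l , 0 , b) (j , 0 , b)
    dec0 : ∀ {l j j' a b} → program l ≡ jzdec zero j j' → MStep (l , suc a , b) (j' , a , b)
    jz1  : ∀ {l j j' a} → program l ≡ jzdec (suc zero) j j' → MStep (l , a , 0) (j , a , 0)
    dec1 : ∀ {l j j' a b} → program l ≡ jzdec (suc zero) j j' → MStep (l , a , suc b) (j' , a , b)

  Halts : Set
  Halts = Σ MConfig λ c → Star MStep (start , 0 , 0) c × program (Data.Product.proj₁ c) ≡ halt
    where import Data.Product

-- Undecidability of a problem P : A → Set, expressed as a (computable,
-- since every Agda function is computable) many-one reduction from the
-- halting problem of two-counter Minsky machines.

Undecidable : {A : Set} → (A → Set) → Set
Undecidable {A} P = Σ (Minsky → A) λ f → ∀ M → Halts M ⇔ P (f M)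

module Submission where

-- A two-counter Minsky machine is simulated by a queue machine whose queue
-- holds the configuration (a , b) as 1^a 0 1^b 0; each machine step cycles this
-- word once through the queue, changing it on the way.  A Z-VASS of dimension 3
-- runs the queue machine without storing the queue: counter #0 holds the word u
-- written so far and counter #1 the word v read so far (negated), both as
-- binary numerals, so writing or reading a letter doubles a counter and adds a
-- digit.  Doubling is a copy into the scratch counter #2 followed by a transfer
-- back.  Reads are guessed, and a final transfer of all counters into #0 tests
-- u = v.  That single equation fixes every letter read, and an invariant of the
-- queue machine (the queue is never empty when a read is possible) shows that no
-- letter is read before it is written, so accepted runs are genuine simulations.

open import Defs hiding (trans)
open import Data.Bool using (Bool; true; false)
open import Data.Empty using (⊥-elim)
open import Data.Fin as Fin using (Fin; zero; suc)
import Data.Fin.Properties as Finₚ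
open import Data.Integer using (ℤ; +_; -_; _+_; _*_; _-_)
import Data.Integer.Properties as ℤₚ
open import Data.Integer.Tactic.RingSolver using (solve-∀)
open import Data.List using (List; []; _∷_; [_]; _++_; _∷ʳ_; replicate; concatMap; allFin; foldl; foldr; map; reverse)
open import Data.List.Membership.Propositional using (_∈_)
open import Data.List.Relation.Binary.Subset.Propositional using (_⊆_)
import Data.List.Membership.Propositional.Properties as ∈ₚ
open import Data.List.Properties using (++-assoc; ++-identityʳ; ∷-injective; ∷ʳ-++; foldl-∷ʳ; reverse-foldr; reverse-injective)
open import Data.List.Relation.Unary.All as All using (All; []; _∷_)
import Data.List.Relation.Unary.All.Properties as Allₚ
open import Data.List.Relation.Unary.Any as Any using (here; there)
open import Data.Nat as ℕ using (ℕ)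
open import Data.Nat.Binary as ℕᵇ using (ℕᵇ; 2[1+_]; 1+[2_]; toℕ)
open import Data.Nat.Binary.Properties using (toℕ-injective)
import Data.Nat.Properties as ℕₚ
open import Data.Product using (∃; ∃₂; _×_; _,_; proj₁; proj₂)
open import Data.Product.Properties using (×-≡,≡→≡)
open import Data.Unit using (⊤)
open import Data.Sum using (_⊎_; inj₁; inj₂)
open import Function using (flip; _∘_)
open import Function.Bundles using (_⇔_; mk⇔)
open import Function.Properties.Equivalence using () renaming (trans to ⇔-trans; sym to ⇔-sym)
open import Function.Definitions using (Injective)
open import Relation.Binary.PropositionalEquality hiding ([_])
open import Relation.Binary.Construct.Closure.ReflexiveTransitive using (Star; ε; _◅_; _◅◅_)
open import Relation.Nullary using (yes; no; ¬_)

δ-zeroOne : ∀ {d} (i j : Fin d) → identity i j ≡ + 0 ⊎ identity i j ≡ + 1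
δ-zeroOne i j with i Fin.≟ j
... | yes _ = inj₂ refl
... | no _  = inj₁ refl

δ-diagonal : ∀ {d} (i : Fin d) → identity i i ≡ + 1
δ-diagonal i with i Fin.≟ i
... | yes _  = refl
... | no i≢i = ⊥-elim (i≢i refl)

δ≡1⇒≡ : ∀ {d} {i j : Fin d} → identity i j ≡ + 1 → i ≡ j
δ≡1⇒≡ {i = i} {j} δ≡1 with i Fin.≟ j
... | yes i≡j = i≡j
... | no _ with () ← δ≡1

transferMatrix : ∀ {d} → (Fin d → Fin d) → Mat d
transferMatrix f i j = identity i (f j)

copyMatrix : ∀ {d} → (Fin d → Fin d) → Mat d
copyMatrix g i j = identity j (g i)

transferMatrix-isTransfer : ∀ {d} (f : Fin d → Fin d) → IsTransfer (transferMatrix f)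
transferMatrix-isTransfer f =
  (λ i j → δ-zeroOne i (f j)) , λ j → f j , δ-diagonal (f j) , λ _ → δ≡1⇒≡

copyMatrix-isCopy : ∀ {d} (g : Fin d → Fin d) → IsCopy (copyMatrix g)
copyMatrix-isCopy g =
  (λ i j → δ-zeroOne j (g i)) , λ i → g i , δ-diagonal (g i) , λ _ → δ≡1⇒≡

pattern #0 = zero
pattern #1 = suc zero
pattern #2 = suc (suc zero)

⟨_,_,_⟩ : ∀ {A : Set} → A → A → A → Fin 3 → A
⟨ x , y , z ⟩ #0 = x
⟨ x , y , z ⟩ #1 = y
⟨ x , y , z ⟩ #2 = z

-- Copying counter k into the scratch counter #2 and transferring it back
-- doubles counter k, which neither a transfer nor a copy matrix can do alone.
doublingMatrix : Fin 3 → Mat 3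
doublingMatrix k = transferMatrix ⟨ #0 , #1 , k ⟩ ⊗ copyMatrix ⟨ #0 , #1 , k ⟩

doublingMatrix-transferCopy : ∀ k → InTransferCopyMonoid (doublingMatrix k)
doublingMatrix-transferCopy k =
  product (transfer (transferMatrix-isTransfer ⟨ #0 , #1 , k ⟩))
          (copy (copyMatrix-isCopy ⟨ #0 , #1 , k ⟩)) λ _ _ → refl

-- Binary encoding of words

digit : Bool → ℕᵇ → ℕᵇ
digit true  = 2[1+_]
digit false = 1+[2_]

weight : Bool → ℕ
weight true  = 2
weight false = 1

toℕ-digit : ∀ d x → toℕ (digit d x) ≡ weight d ℕ.+ 2 ℕ.* toℕ x
toℕ-digit true  x = ℕₚ.*-suc 2 (toℕ x)
toℕ-digit false x = refl

code : List Bool → ℕᵇ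
code = foldl (flip digit) ℕᵇ.zero

digit-injective : ∀ d e {x y} → digit d x ≡ digit e y → d ≡ e × x ≡ y
digit-injective true  true  refl = refl , refl
digit-injective false false refl = refl , refl
digit-injective true  false ()
digit-injective false true  ()

digit≢zero : ∀ d {x} → digit d x ≢ ℕᵇ.zero
digit≢zero true  ()
digit≢zero false ()

foldr-digit-injective : Injective _≡_ _≡_ (foldr digit ℕᵇ.zero)
foldr-digit-injective {[]}     {[]}     _  = refl
foldr-digit-injective {[]}     {e ∷ ys} eq = ⊥-elim (digit≢zero e (sym eq))
foldr-digit-injective {d ∷ xs} {[]}     eq = ⊥-elim (digit≢zero d eq)
foldr-digit-injective {d ∷ xs} {e ∷ ys} eq with digit-injective d e eq
... | refl , eq′ = cong (d ∷_) (foldr-digit-injective eq′)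

code-injective : Injective _≡_ _≡_ code
code-injective {xs} {ys} eq = reverse-injective (foldr-digit-injective (begin
  foldr digit ℕᵇ.zero (reverse xs) ≡⟨ reverse-foldr digit ℕᵇ.zero xs ⟩
  code xs                          ≡⟨ eq ⟩
  code ys                          ≡⟨ reverse-foldr digit ℕᵇ.zero ys ⟨
  foldr digit ℕᵇ.zero (reverse ys) ∎))
  where open ≡-Reasoning

-- The bijective base-2 numeral of w, most significant letter first: appending
-- a letter doubles the value and adds 1 or 2, and distinct words get distinct values.
⟦_⟧ : List Bool → ℤ
⟦ w ⟧ = + toℕ (code w)

⟦⟧-injective : Injective _≡_ _≡_ ⟦_⟧
⟦⟧-injective eq = code-injective (toℕ-injective (ℤₚ.+-injective eq))

⟦∷ʳ⟧ : ∀ w d → ⟦ w ∷ʳ d ⟧ ≡ + weight d + + 2 * ⟦ w ⟧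
⟦∷ʳ⟧ w d = begin
  + toℕ (code (w ∷ʳ d))                     ≡⟨ cong (+_ ∘ toℕ) (foldl-∷ʳ (flip digit) ℕᵇ.zero d w) ⟩
  + toℕ (digit d (code w))                  ≡⟨ cong +_ (toℕ-digit d (code w)) ⟩
  + (weight d ℕ.+ 2 ℕ.* toℕ (code w))       ≡⟨ ℤₚ.pos-+ (weight d) (2 ℕ.* toℕ (code w)) ⟩
  + weight d + + (2 ℕ.* toℕ (code w))     ≡⟨ cong (_+_ (+ weight d)) (ℤₚ.pos-* 2 (toℕ (code w))) ⟩
  + weight d + + 2 * ⟦ w ⟧              ∎
  where open ≡-Reasoning

-- Word-pair automata

data Action : Set where
  push pop : Bool → Action

Edge : Set → Set
Edge S = S × Action × S

infix 6 _─[_]→_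
_─[_]→_ : ∀ {S : Set} → S → Action → S → Edge S
s ─[ a ]→ s′ = s , a , s′

data Path {S : Set} (E : List (Edge S)) : S → S → List Bool → List Bool → Set where
  []   : ∀ {s} → Path E s s [] []
  push : ∀ {s s₁ s₂ d P Q} → s ─[ push d ]→ s₁ ∈ E → Path E s₁ s₂ P Q → Path E s s₂ (d ∷ P) Q
  pop  : ∀ {s s₁ s₂ d P Q} → s ─[ pop d ]→ s₁ ∈ E → Path E s₁ s₂ P Q → Path E s s₂ P (d ∷ Q)

infixr 5 _++ᴾ_
_++ᴾ_ : ∀ {S : Set} {E : List (Edge S)} {s₁ s₂ s₃ P Q P′ Q′} →
        Path E s₁ s₂ P Q → Path E s₂ s₃ P′ Q′ → Path E s₁ s₃ (P ++ P′) (Q ++ Q′)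
[]           ++ᴾ path′ = path′
push e∈ path ++ᴾ path′ = push e∈ (path ++ᴾ path′)
pop e∈ path  ++ᴾ path′ = pop e∈ (path ++ᴾ path′)

Accepted : ∀ {S : Set} → List (Edge S) → S → S → List Bool → List Bool → Set
Accepted E s f u v = ∃₂ λ P Q → Path E s f P Q × u ++ P ≡ v ++ Q

-- The Z-VASS of a word-pair automaton

pushMatrix popMatrix checkMatrix : Mat 3
pushMatrix  = doublingMatrix #0
popMatrix   = doublingMatrix #1
checkMatrix = transferMatrix λ _ → #0

matrix : Action → Mat 3
matrix (push _) = pushMatrix
matrix (pop _)  = popMatrix

matrix-transferCopy : ∀ a → InTransferCopyMonoid (matrix a)
matrix-transferCopy (push _) = doublingMatrix-transferCopy #0
matrix-transferCopy (pop _)  = doublingMatrix-transferCopy #1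

offset : Action → Vecℤ 3
offset (push d) = ⟨ + weight d , + 0 , + 0 ⟩
offset (pop d)  = ⟨ + 0 , - + weight d , + 0 ⟩

enc : List Bool → List Bool → Vecℤ 3
enc u v = ⟨ ⟦ u ⟧ , - ⟦ v ⟧ , + 0 ⟩

-- The left-hand sides below are the normal forms of the matrix products.
push-enc : ∀ u v d → (pushMatrix · enc u v) +ᵥ offset (push d) ≗ enc (u ∷ʳ d) v
push-enc u v d #0 = trans (double ⟦ u ⟧ (+ weight d)) (sym (⟦∷ʳ⟧ u d))
  where double : ∀ x c → + 2 * x + (+ 0 + (+ 0 + + 0)) + c ≡ c + + 2 * x
        double = solve-∀
push-enc u v d #1 = keep (- ⟦ v ⟧)
  where keep : ∀ y → + 0 + (+ 1 * y + (+ 0 + + 0)) + + 0 ≡ y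
        keep = solve-∀
push-enc u v d #2 = refl

pop-enc : ∀ u v d → (popMatrix · enc u v) +ᵥ offset (pop d) ≗ enc u (v ∷ʳ d)
pop-enc u v d #0 = keep ⟦ u ⟧
  where keep : ∀ x → + 1 * x + (+ 0 + (+ 0 + + 0)) + + 0 ≡ x
        keep = solve-∀
pop-enc u v d #1 = trans (double ⟦ v ⟧ (+ weight d)) (cong -_ (sym (⟦∷ʳ⟧ v d)))
  where double : ∀ y c → + 0 + (+ 2 * - y + (+ 0 + + 0)) + - c ≡ - (c + + 2 * y)
        double = solve-∀
pop-enc u v d #2 = refl

check-enc : ∀ u v → (checkMatrix · enc u v) #0 ≡ ⟦ u ⟧ - ⟦ v ⟧
check-enc u v = difference ⟦ u ⟧ ⟦ v ⟧
  where difference : ∀ x y → + 1 * x + (+ 1 * - y + (+ 0 + + 0)) ≡ x - y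
        difference = solve-∀

sumFin-cong : ∀ {n} {f g : Fin n → ℤ} → f ≗ g → sumFin f ≡ sumFin g
sumFin-cong {ℕ.zero}  _   = refl
sumFin-cong {ℕ.suc n} f≗g = cong₂ _+_ (f≗g zero) (sumFin-cong (f≗g ∘ suc))

affine-cong : ∀ {d} (A : Mat d) (b : Vecℤ d) {w w′} → w ≗ w′ → (A · w) +ᵥ b ≗ (A · w′) +ᵥ b
affine-cong A b w≗w′ i = cong (_+ b i) (sumFin-cong λ j → cong (A i j *_) (w≗w′ j))

module WordPairVASS {n} {S : Set} (index : S → Fin n) (index-injective : Injective _≡_ _≡_ index)
                    (E : List (Edge S)) (final : S) where

  transition : Edge S → Transition 3 (ℕ.suc n)
  transition (s , a , s′) = record
    { src = suc (index s) ; mat = matrix a ; vec = offset a ; tgt = suc (index s′) }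

  check : Transition 3 (ℕ.suc n)
  check = record
    { src = suc (index final) ; mat = checkMatrix ; vec = ⟨ + 0 , + 0 , + 0 ⟩ ; tgt = zero }

  vass : AffineZVASS 3
  vass = record { nStates = ℕ.suc n ; transitions = check ∷ map transition E }

  vass-transferCopy : IsTransferCopy vass
  vass-transferCopy _ (here refl) = transfer (transferMatrix-isTransfer _)
  vass-transferCopy _ (there t∈) with ∈ₚ.∈-map⁻ transition t∈
  ... | (_ , a , _) , _ , refl = matrix-transferCopy a

  config : S → List Bool → List Bool → Config vass
  config s u v = suc (index s) , enc u v

  accept : Config vass
  accept = zero , ⟨ + 0 , + 0 , + 0 ⟩

  push-step : ∀ {s d s′ u v} → s ─[ push d ]→ s′ ∈ E → Step vass (config s u v) (config s′ (u ∷ʳ d) v)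
  push-step {u = u} {v} e∈ =
    _ , there (∈ₚ.∈-map⁺ transition e∈) , refl , refl , λ i → sym (push-enc u v _ i)

  pop-step : ∀ {s d s′ u v} → s ─[ pop d ]→ s′ ∈ E → Step vass (config s u v) (config s′ u (v ∷ʳ d))
  pop-step {u = u} {v} e∈ =
    _ , there (∈ₚ.∈-map⁺ transition e∈) , refl , refl , λ i → sym (pop-enc u v _ i)

  check-step : ∀ {u} → Step vass (config final u u) accept
  check-step {u} = check , here refl , refl , refl , λ
    { #0 → sym (trans (ℤₚ.+-identityʳ _) (trans (check-enc u u) (ℤₚ.+-inverseʳ ⟦ u ⟧)))
    ; #1 → refl
    ; #2 → refl }

  accepted⇒reach : ∀ {s u v P Q} → Path E s final P Q → u ++ P ≡ v ++ Q → Reach vass (config s u v) accept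
  accepted⇒reach {u = u} {v} [] eq
    with refl ← trans (sym (++-identityʳ u)) (trans eq (++-identityʳ v)) = check-step {u} ◅ ε
  accepted⇒reach {u = u} {v} (push {d = d} {P = P} e∈ path) eq =
    push-step {u = u} {v} e∈ ◅ accepted⇒reach path (trans (∷ʳ-++ u d P) eq)
  accepted⇒reach {u = u} {v} (pop {d = d} {Q = Q} e∈ path) eq =
    pop-step {u = u} {v} e∈ ◅ accepted⇒reach path (trans eq (sym (∷ʳ-++ v d Q)))

  -- Without function extensionality a step only determines its target vector
  -- pointwise, hence the hypotheses w ≗ enc u v.
  data StepFrom (s : S) (u v : List Bool) : Config vass → Set where
    pushed  : ∀ {d s′ w} → s ─[ push d ]→ s′ ∈ E → w ≗ enc (u ∷ʳ d) v → StepFrom s u v (suc (index s′) , w)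
    popped  : ∀ {d s′ w} → s ─[ pop d ]→ s′ ∈ E → w ≗ enc u (v ∷ʳ d) → StepFrom s u v (suc (index s′) , w)
    checked : ∀ {w} → s ≡ final → w #0 ≡ ⟦ u ⟧ - ⟦ v ⟧ → StepFrom s u v (zero , w)

  step-view : ∀ {s w c} u v → w ≗ enc u v → Step vass (suc (index s) , w) c → StepFrom s u v c
  step-view {w = w} u v w≗ (_ , here refl , src , refl , eqs) =
    checked (sym (index-injective (Finₚ.suc-injective src))) (begin
      _                                           ≡⟨ eqs #0 ⟩
      (checkMatrix · w) #0 + + 0                  ≡⟨ affine-cong checkMatrix ⟨ + 0 , + 0 , + 0 ⟩ w≗ #0 ⟩
      (checkMatrix · enc u v) #0 + + 0            ≡⟨ ℤₚ.+-identityʳ _ ⟩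
      (checkMatrix · enc u v) #0                  ≡⟨ check-enc u v ⟩
      ⟦ u ⟧ - ⟦ v ⟧                               ∎)
    where open ≡-Reasoning
  step-view u v w≗ (_ , there t∈ , src , tgt , eqs) with ∈ₚ.∈-map⁻ transition t∈
  ... | (_ , a , _) , e∈ , refl with refl ← index-injective (Finₚ.suc-injective src) | refl ← tgt with a
  ... | push d = pushed e∈ λ i → trans (eqs i) (trans (affine-cong pushMatrix (offset (push d)) w≗ i) (push-enc u v d i))
  ... | pop d  = popped e∈ λ i → trans (eqs i) (trans (affine-cong popMatrix (offset (pop d)) w≗ i) (pop-enc u v d i))

  accept-stuck : ∀ {w c} → ¬ Step vass (zero , w) c
  accept-stuck (_ , here refl , () , _)
  accept-stuck (_ , there t∈ , src , _) with ∈ₚ.∈-map⁻ transition t∈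
  ... | _ , _ , refl with () ← src

  reach⇒accepted : ∀ {s w} u v → w ≗ enc u v → Reach vass (suc (index s) , w) accept → Accepted E s final u v
  reach⇒accepted u v w≗ (step ◅ steps) with step-view u v w≗ step
  ... | pushed {d} e∈ w′≗ with P , Q , path , eq ← reach⇒accepted (u ∷ʳ d) v w′≗ steps =
    d ∷ P , Q , push e∈ path , trans (sym (∷ʳ-++ u d P)) eq
  ... | popped {d} e∈ w′≗ with P , Q , path , eq ← reach⇒accepted u (v ∷ʳ d) w′≗ steps =
    P , d ∷ Q , pop e∈ path , trans eq (∷ʳ-++ v d Q)
  ... | checked {w′} refl w₀ with steps
  ...   | step′ ◅ _ = ⊥-elim (accept-stuck {w′} step′)
  ...   | ε = [] , [] , [] ,
              cong (_++ []) (⟦⟧-injective (ℤₚ.i-j≡0⇒i≡j ⟦ u ⟧ ⟦ v ⟧ (sym w₀)))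

  reach⇔accepted : ∀ {s u v} → Reach vass (config s u v) accept ⇔ Accepted E s final u v
  reach⇔accepted = mk⇔ (reach⇒accepted _ _ λ _ → refl) λ (_ , _ , path , eq) → accepted⇒reach path eq

-- Queue invariants

Preserves : ∀ {S : Set} → (S → List Bool → Set) → Edge S → Set
Preserves Inv (s , push d , s′) = ∀ {w} → Inv s w → Inv s′ (w ∷ʳ d)
Preserves Inv (s , pop d , s′)  = (∀ {w} → Inv s (d ∷ w) → Inv s′ w) × ¬ Inv s []

-- w is the queue content.  The final equation w ++ P ≡ Q ++ r fixes the letter
-- read by every pop, and ¬ Inv s [] rules out reading a letter before it is written.
path-preserves : ∀ {S : Set} {E : List (Edge S)} {Inv : S → List Bool → Set} →
                 All (Preserves Inv) E → ∀ {s s′ P Q w r} → Path E s s′ P Q →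
                 Inv s w → w ++ P ≡ Q ++ r → Inv s′ r
path-preserves {Inv = Inv} preserved {s = s} {w = w} [] inv refl = subst (Inv s) (sym (++-identityʳ w)) inv
path-preserves preserved {w = w} (push {d = d} {P = P} e∈ path) inv eq =
  path-preserves preserved path (All.lookup preserved e∈ inv) (trans (∷ʳ-++ w d P) eq)
path-preserves preserved {w = []} (pop e∈ path) inv eq =
  ⊥-elim (proj₂ (All.lookup preserved e∈) inv)
path-preserves preserved {w = _ ∷ _} (pop e∈ path) inv eq with refl , eq′ ← ∷-injective eq =
  path-preserves preserved path (proj₁ (All.lookup preserved e∈) inv) eq′

block : ℕ → List Bool → List Bool
block c w = replicate c true ++ false ∷ w

⟪_,_⟫ : ℕ → ℕ → List Bool
⟪ a , b ⟫ = block a (block b [])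

block-∷ʳ : ∀ c w d → block c w ∷ʳ d ≡ block c (w ∷ʳ d)
block-∷ʳ c w d = ++-assoc (replicate c true) (false ∷ w) [ d ]

⟪⟫-∷ʳ : ∀ a b d → ⟪ a , b ⟫ ∷ʳ d ≡ block a (block b [ d ])
⟪⟫-∷ʳ a b d = trans (block-∷ʳ a (block b []) d) (cong (block a) (block-∷ʳ b [] d))

replicate-∷ʳ : ∀ {A : Set} n (x : A) → replicate n x ∷ʳ x ≡ x ∷ replicate n x
replicate-∷ʳ ℕ.zero    x = refl
replicate-∷ʳ (ℕ.suc n) x = cong (x ∷_) (replicate-∷ʳ n x)

block≢[] : ∀ c {w} → block c w ≢ []
block≢[] ℕ.zero    ()
block≢[] (ℕ.suc c) ()

record Copying (T : ℕ → ℕ → Set) (w : List Bool) : Set where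
  constructor copying
  field
    counter copied remaining : ℕ
    holds : T counter (copied ℕ.+ remaining)
    shape : w ≡ block remaining (block counter (replicate copied true))

record Copied (T : ℕ → ℕ → Set) (w : List Bool) : Set where
  constructor copied
  field
    counter copied : ℕ
    holds : T counter copied
    shape : w ≡ block counter (replicate copied true)

Encodes : (ℕ → ℕ → Set) → List Bool → Set
Encodes T w = ∃₂ λ a b → T a b × w ≡ ⟪ a , b ⟫

module _ {T : ℕ → ℕ → Set} where

  copying-pop-one : ∀ {w} → Copying T (true ∷ w) → Copying (λ c x → T c (ℕ.suc x)) w
  copying-pop-one (copying c i (ℕ.suc k) t refl) = copying c i k (subst (T c) (ℕₚ.+-suc i k) t) refl

  copying-push-one : ∀ {w} → Copying (λ c x → T c (ℕ.suc x)) w → Copying T (w ∷ʳ true)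
  copying-push-one (copying c i k t refl) = copying c (ℕ.suc i) k t (begin
    block k (block c (replicate i true)) ∷ʳ true   ≡⟨ block-∷ʳ k _ true ⟩
    block k (block c (replicate i true) ∷ʳ true)   ≡⟨ cong (block k) (block-∷ʳ c _ true) ⟩
    block k (block c (replicate i true ∷ʳ true))   ≡⟨ cong (block k ∘ block c) (replicate-∷ʳ i true) ⟩
    block k (block c (replicate (ℕ.suc i) true))   ∎)
    where open ≡-Reasoning

  copying-pop-separator : ∀ {w} → Copying T (false ∷ w) → Copied T w
  copying-pop-separator (copying c i ℕ.zero t refl) = copied c i (subst (T c) (ℕₚ.+-identityʳ i) t) refl

  copying≢[] : ¬ Copying T []
  copying≢[] (copying _ _ k _ eq) = block≢[] k (sym eq)

  copied-∷ʳ-false : ∀ {w} → Copied T w → Encodes T (w ∷ʳ false)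
  copied-∷ʳ-false (copied c i t refl) = c , i , t , block-∷ʳ c (replicate i true) false

  encodes-pop-one : ∀ {w} → Encodes T (true ∷ w) → Copying (λ b x → T (ℕ.suc x) b) w
  encodes-pop-one (ℕ.suc a , b , t , refl) = copying b 0 a t refl

  encodes-pop-zero : ∀ {w} → Encodes T (false ∷ w) → Copied (λ b x → T x b) w
  encodes-pop-zero (ℕ.zero , b , t , refl) = copied b 0 t refl

  encodes≢[] : ¬ Encodes T []
  encodes≢[] (a , _ , _ , eq) = block≢[] a (sym eq)

copier : ∀ {S : Set} → S → S → S → S → List (Edge S)
copier s s′ s₀ next =
  s ─[ pop true ]→ s′ ∷ s′ ─[ push true ]→ s ∷ s ─[ pop false ]→ s₀ ∷ s₀ ─[ push false ]→ next ∷ []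

module _ {S : Set} {E : List (Edge S)} {t : S} {P Q : List Bool} where

  copier-path : ∀ {s s′ s₀ next} → copier s s′ s₀ next ⊆ E →
                ∀ c → Path E next t P Q → Path E s t (block c P) (block c Q)
  copier-path sub ℕ.zero    rest = pop (sub (there (there (here refl)))) (push (sub (there (there (there (here refl))))) rest)
  copier-path sub (ℕ.suc c) rest = pop (sub (here refl)) (push (sub (there (here refl))) (copier-path sub c rest))

  copier-path-from : ∀ {r s s′ s₀ next} → r ─[ pop true ]→ s′ ∈ E → r ─[ pop false ]→ s₀ ∈ E →
                     copier s s′ s₀ next ⊆ E → ∀ c → Path E next t P Q → Path E r t (block c P) (block c Q)
  copier-path-from one sep sub ℕ.zero    rest = pop sep (push (sub (there (there (there (here refl))))) rest)
  copier-path-from one sep sub (ℕ.suc c) rest = pop one (push (sub (there (here refl))) (copier-path sub c rest))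

  pop-block : ∀ {s next} → s ─[ pop true ]→ s ∈ E → s ─[ pop false ]→ next ∈ E →
              ∀ c → Path E next t P Q → Path E s t P (block c Q)
  pop-block one sep ℕ.zero    rest = pop sep rest
  pop-block one sep (ℕ.suc c) rest = pop one (pop-block one sep c rest)

-- Encoding two-counter Minsky machines

module MinskyEncoding (M : Minsky) where
  open Minsky M

  -- Phases are numbered consecutively, so that states embed into Fin (nInstr * 16).
  Phase : Set
  Phase = Fin 16

  pattern ready  = zero
  pattern copyA  = suc ready
  pattern copyA′ = suc copyA
  pattern copyA₀ = suc copyA′
  pattern rotA   = suc copyA₀
  pattern rotA′  = suc rotA
  pattern rotA₀  = suc rotA′
  pattern afterA = suc rotA₀
  pattern bZero  = suc afterA
  pattern aZero  = suc bZero
  pattern copyB  = suc aZero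
  pattern copyB′ = suc copyB
  pattern copyB₀ = suc copyB′
  pattern drainA = suc copyB₀
  pattern drainB = suc drainA
  pattern halted = suc drainB

  State : Set
  State = Fin nInstr × Phase

  index : State → Fin (nInstr ℕ.* 16)
  index (l , p) = Fin.combine l p

  index-injective : Injective _≡_ _≡_ index
  index-injective {l , p} {l′ , p′} eq = ×-≡,≡→≡ (Finₚ.combine-injective l p l′ p′ eq)

  Reached : MConfig M → Set
  Reached = Star (MStep M) (start , 0 , 0)

  _▷_ : ∀ {c c′} → Reached c → MStep M c c′ → Reached c′
  r ▷ step = r ◅◅ (step ◅ ε)

  first second : Fin nInstr → ℕ → ℕ → Set
  first  t c x = Reached (t , x , c)
  second t c x = Reached (t , c , x)

  Inv : State → List Bool → Set
  Inv (t , ready)  = Encodes (second t)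
  Inv (t , copyA)  = Copying (first t)
  Inv (t , copyA′) = Copying (λ c x → first t c (ℕ.suc x))
  Inv (t , copyA₀) = Copied (first t)
  Inv (t , rotA)   = Copying (first t)
  Inv (t , rotA′)  = Copying (λ c x → first t c (ℕ.suc x))
  Inv (t , rotA₀)  = Copied (first t)
  Inv (t , afterA) = Encodes (first t)
  Inv (t , bZero)  = λ w → ∃ λ a → Reached (t , a , 0) × w ≡ block a []
  Inv (t , aZero)  = λ w → ∃ λ b → Reached (t , 0 , b) × w ≡ block b []
  Inv (t , copyB)  = Copying (second t)
  Inv (t , copyB′) = Copying (λ c x → second t c (ℕ.suc x))
  Inv (t , copyB₀) = Copied (second t)
  Inv (_ , drainA) = λ w → Halts M × Encodes (λ _ _ → ⊤) w
  Inv (_ , drainB) = λ w → Halts M × ∃ λ b → w ≡ block b []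
  Inv (_ , halted) = λ _ → Halts M

  -- copyA and copyB move the two counters to the back of the queue unchanged;
  -- rotA moves only the first one, leaving the second one at the head of the
  -- queue in phase afterA, where the instructions on the second counter act.
  copyA-copier rotA-copier copyB-copier : Fin nInstr → List (Edge State)
  copyA-copier t = copier (t , copyA) (t , copyA′) (t , copyA₀) (t , copyB)
  rotA-copier  t = copier (t , rotA) (t , rotA′) (t , rotA₀) (t , afterA)
  copyB-copier t = copier (t , copyB) (t , copyB′) (t , copyB₀) (t , ready)

  instructionEdges : Fin nInstr → Instr nInstr → List (Edge State)
  instructionEdges l (inc zero j) =
    (l , ready) ─[ push true ]→ (j , copyA) ∷ []
  instructionEdges l (inc (suc zero) j) =
    (l , ready) ─[ pop true ]→ (l , rotA′) ∷ (l , ready) ─[ pop false ]→ (l , rotA₀) ∷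
    (l , afterA) ─[ push true ]→ (j , copyB) ∷ []
  instructionEdges l (jzdec zero j j′) =
    (l , ready) ─[ pop false ]→ (l , aZero) ∷ (l , aZero) ─[ push false ]→ (j , copyB) ∷
    (l , ready) ─[ pop true ]→ (j′ , copyA) ∷ []
  instructionEdges l (jzdec (suc zero) j j′) =
    (l , ready) ─[ pop true ]→ (l , rotA′) ∷ (l , ready) ─[ pop false ]→ (l , rotA₀) ∷
    (l , afterA) ─[ pop false ]→ (l , bZero) ∷ (l , bZero) ─[ push false ]→ (j , ready) ∷
    (l , afterA) ─[ pop true ]→ (j′ , copyB) ∷ []
  instructionEdges l halt =
    (l , ready) ─[ pop true ]→ (start , drainA) ∷ (l , ready) ─[ pop false ]→ (start , drainB) ∷ []

  drainEdges : List (Edge State)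
  drainEdges =
    (start , drainA) ─[ pop true ]→ (start , drainA) ∷ (start , drainA) ─[ pop false ]→ (start , drainB) ∷
    (start , drainB) ─[ pop true ]→ (start , drainB) ∷ (start , drainB) ─[ pop false ]→ (start , halted) ∷ []

  labelEdges : Fin nInstr → List (Edge State)
  labelEdges t = instructionEdges t (program t) ++ copyA-copier t ++ rotA-copier t ++ copyB-copier t

  edges : List (Edge State)
  edges = concatMap labelEdges (allFin nInstr) ++ drainEdges

  labelEdges⊆ : ∀ t → labelEdges t ⊆ edges
  labelEdges⊆ t e∈ = ∈ₚ.∈-++⁺ˡ (∈ₚ.∈-concatMap⁺ labelEdges (Any.map (λ { refl → e∈ }) (∈ₚ.∈-allFin t)))

  instructionEdges⊆ : ∀ l {ins} → program l ≡ ins → instructionEdges l ins ⊆ edges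
  instructionEdges⊆ l refl e∈ = labelEdges⊆ l (∈ₚ.∈-++⁺ˡ e∈)

  copiers⊆ : ∀ t → copyA-copier t ++ rotA-copier t ++ copyB-copier t ⊆ edges
  copiers⊆ t = labelEdges⊆ t ∘ ∈ₚ.∈-++⁺ʳ (instructionEdges t (program t))

  copyA⊆ : ∀ t → copyA-copier t ⊆ edges
  copyA⊆ t = copiers⊆ t ∘ ∈ₚ.∈-++⁺ˡ

  rotA⊆ : ∀ t → rotA-copier t ⊆ edges
  rotA⊆ t = copiers⊆ t ∘ ∈ₚ.∈-++⁺ʳ (copyA-copier t) ∘ ∈ₚ.∈-++⁺ˡ

  copyB⊆ : ∀ t → copyB-copier t ⊆ edges
  copyB⊆ t = copiers⊆ t ∘ ∈ₚ.∈-++⁺ʳ (copyA-copier t) ∘ ∈ₚ.∈-++⁺ʳ (rotA-copier t)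

  drainEdges⊆ : drainEdges ⊆ edges
  drainEdges⊆ = ∈ₚ.∈-++⁺ʳ (concatMap labelEdges (allFin nInstr))

  copiers-preserve : ∀ t → All (Preserves Inv) (copyA-copier t ++ rotA-copier t ++ copyB-copier t)
  copiers-preserve t =
    (copying-pop-one , copying≢[]) ∷ copying-push-one ∷ (copying-pop-separator , copying≢[]) ∷ copyA-exit ∷
    (copying-pop-one , copying≢[]) ∷ copying-push-one ∷ (copying-pop-separator , copying≢[]) ∷ copied-∷ʳ-false ∷
    (copying-pop-one , copying≢[]) ∷ copying-push-one ∷ (copying-pop-separator , copying≢[]) ∷ copied-∷ʳ-false ∷ []
    where
    copyA-exit : ∀ {w} → Copied (first t) w → Copying (second t) (w ∷ʳ false)
    copyA-exit c with b , a , r , eq ← copied-∷ʳ-false c = copying a 0 b r eq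

  instruction-preserves : ∀ l {ins} → program l ≡ ins → All (Preserves Inv) (instructionEdges l ins)
  instruction-preserves l {inc zero j} peq =
    (λ { (a , b , r , refl) → copying b 1 a (r ▷ inc0 peq) (⟪⟫-∷ʳ a b true) }) ∷ []
  instruction-preserves l {inc (suc zero) j} peq =
    (encodes-pop-one , encodes≢[]) ∷ (encodes-pop-zero , encodes≢[]) ∷
    (λ { (b , a , r , refl) → copying a 1 b (r ▷ inc1 peq) (⟪⟫-∷ʳ b a true) }) ∷ []
  instruction-preserves l {jzdec zero j j′} peq =
    ((λ { (ℕ.zero , b , r , refl) → b , r , refl }) , encodes≢[]) ∷
    (λ { (b , r , refl) → copying 0 0 b (r ▷ jz0 peq) (block-∷ʳ b [] false) }) ∷
    ((λ { (ℕ.suc a , b , r , refl) → copying b 0 a (r ▷ dec0 peq) refl }) , encodes≢[]) ∷ []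
  instruction-preserves l {jzdec (suc zero) j j′} peq =
    (encodes-pop-one , encodes≢[]) ∷ (encodes-pop-zero , encodes≢[]) ∷
    ((λ { (ℕ.zero , a , r , refl) → a , r , refl }) , encodes≢[]) ∷
    (λ { (a , r , refl) → a , 0 , r ▷ jz1 peq , block-∷ʳ a [] false }) ∷
    ((λ { (ℕ.suc b , a , r , refl) → copying a 0 b (r ▷ dec1 peq) refl }) , encodes≢[]) ∷ []
  instruction-preserves l {halt} peq =
    ((λ { (ℕ.suc a , b , r , refl) → ((l , ℕ.suc a , b) , r , peq) , a , b , _ , refl }) , encodes≢[]) ∷
    ((λ { (ℕ.zero , b , r , refl) → ((l , 0 , b) , r , peq) , b , refl }) , encodes≢[]) ∷ []

  drain-preserves : All (Preserves Inv) drainEdges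
  drain-preserves =
    ((λ { (h , ℕ.suc a , b , _ , refl) → h , a , b , _ , refl }) , encodes≢[] ∘ proj₂) ∷
    ((λ { (h , ℕ.zero , b , _ , refl) → h , b , refl }) , encodes≢[] ∘ proj₂) ∷
    ((λ { (h , ℕ.suc b , refl) → h , b , refl }) , λ (_ , b , eq) → block≢[] b (sym eq)) ∷
    ((λ { (h , ℕ.zero , refl) → h }) , λ (_ , b , eq) → block≢[] b (sym eq)) ∷ []

  edges-preserve : All (Preserves Inv) edges
  edges-preserve = Allₚ.++⁺ (Allₚ.concat⁺ (Allₚ.map⁺ labels-preserve)) drain-preserves
    where
    labels-preserve : All (All (Preserves Inv) ∘ labelEdges) (allFin nInstr)
    labels-preserve = All.tabulate λ {t} _ → Allₚ.++⁺ (instruction-preserves t refl) (copiers-preserve t)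

  recopy : ∀ t a b → Path edges (t , copyA) (t , ready) ⟪ a , b ⟫ ⟪ a , b ⟫
  recopy t a b = copier-path (copyA⊆ t) a (copier-path (copyB⊆ t) b [])

  simulate : ∀ {l a b l′ a′ b′} → MStep M (l , a , b) (l′ , a′ , b′) →
             Path edges (l , ready) (l′ , ready) ⟪ a′ , b′ ⟫ ⟪ a , b ⟫
  simulate (inc0 {l} {j} {a} {b} peq) = push (edge (here refl)) (recopy j a b)
    where edge = instructionEdges⊆ l peq
  simulate (inc1 {l} {j} {a} {b} peq) =
    copier-path-from (edge (here refl)) (edge (there (here refl))) (rotA⊆ l) a
      (push (edge (there (there (here refl)))) (copier-path (copyB⊆ j) b []))
    where edge = instructionEdges⊆ l peq
  simulate (jz0 {l} {j} {b = b} peq) =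
    pop (edge (here refl)) (push (edge (there (here refl))) (copier-path (copyB⊆ j) b []))
    where edge = instructionEdges⊆ l peq
  simulate (dec0 {l} {j' = j′} {a} {b} peq) = pop (edge (there (there (here refl)))) (recopy j′ a b)
    where edge = instructionEdges⊆ l peq
  simulate (jz1 {l} {a = a} peq) =
    copier-path-from (edge (here refl)) (edge (there (here refl))) (rotA⊆ l) a
      (pop (edge (there (there (here refl)))) (push (edge (there (there (there (here refl))))) []))
    where edge = instructionEdges⊆ l peq
  simulate (dec1 {l} {j' = j′} {a} {b} peq) =
    copier-path-from (edge (here refl)) (edge (there (here refl))) (rotA⊆ l) a
      (pop (edge (there (there (there (there (here refl)))))) (copier-path (copyB⊆ j′) b []))
    where edge = instructionEdges⊆ l peq

  run-path : ∀ {l a b l′ a′ b′} → Star (MStep M) (l , a , b) (l′ , a′ , b′) →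
             ∃₂ λ P Q → Path edges (l , ready) (l′ , ready) P Q × ⟪ a , b ⟫ ++ P ≡ Q ++ ⟪ a′ , b′ ⟫
  run-path {a = a} {b} ε = [] , [] , [] , ++-identityʳ ⟪ a , b ⟫
  run-path {a = a} {b} (_◅_ {j = _ , a₁ , b₁} step steps) with P , Q , path , eq ← run-path steps =
    ⟪ a₁ , b₁ ⟫ ++ P , ⟪ a , b ⟫ ++ Q , simulate step ++ᴾ path ,
    trans (cong (⟪ a , b ⟫ ++_) eq) (sym (++-assoc ⟪ a , b ⟫ Q _))

  drainB-path : ∀ b → Path edges (start , drainB) (start , halted) [] (block b [])
  drainB-path b = pop-block (drainEdges⊆ (there (there (here refl)))) (drainEdges⊆ (there (there (there (here refl))))) b []

  drainA-path : ∀ a b → Path edges (start , drainA) (start , halted) [] (block a (block b []))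
  drainA-path a b = pop-block (drainEdges⊆ (here refl)) (drainEdges⊆ (there (here refl))) a (drainB-path b)

  halt-path : ∀ {l} → program l ≡ halt → ∀ a b → Path edges (l , ready) (start , halted) [] ⟪ a , b ⟫
  halt-path {l} peq ℕ.zero    b = pop (instructionEdges⊆ l peq (there (here refl))) (drainB-path b)
  halt-path {l} peq (ℕ.suc a) b = pop (instructionEdges⊆ l peq (here refl)) (drainA-path a b)

  halts⇔accepted : Halts M ⇔ Accepted edges (start , ready) (start , halted) ⟪ 0 , 0 ⟫ []
  halts⇔accepted = mk⇔ halts⇒accepted accepted⇒halts
    where
    halts⇒accepted : Halts M → Accepted edges (start , ready) (start , halted) ⟪ 0 , 0 ⟫ []
    halts⇒accepted ((l , a , b) , r , peq) with P , Q , path , eq ← run-path r =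
      P ++ [] , Q ++ ⟪ a , b ⟫ , path ++ᴾ halt-path peq a b , trans (cong (⟪ 0 , 0 ⟫ ++_) (++-identityʳ P)) eq
    accepted⇒halts : Accepted edges (start , ready) (start , halted) ⟪ 0 , 0 ⟫ [] → Halts M
    accepted⇒halts (P , Q , path , eq) =
      path-preserves edges-preserve path (0 , 0 , ε , refl) (trans eq (sym (++-identityʳ Q)))

  open WordPairVASS index index-injective edges (start , halted)

  reachInstance : TCReachInstance 3
  reachInstance = record
    { vass = vass ; isTC = vass-transferCopy ; source = config (start , ready) ⟪ 0 , 0 ⟫ [] ; target = accept }

  halts⇔reachable : Halts M ⇔ TCReachable reachInstance
  halts⇔reachable = ⇔-trans halts⇔accepted (⇔-sym reach⇔accepted)

proposition6p3 : Undecidable (TCReachable {3})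
proposition6p3 = MinskyEncoding.reachInstance , MinskyEncoding.halts⇔reachable
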